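{- Let $T$ be a complete theory with monster model $\mathcal{U}$, $A\subseteq\mathcal{U}$ small, $\mu\in\mathfrak{M}_x(\mathcal{U})$, $\nu\in\mathfrak{M}_y(\mathcal{U})$, and suppose $\lambda\in\mathfrak{M}_{xy}(A)$ witnesses $\mu\geq_{\mathbb{E},A}\nu$. Then for every $\psi(y)\in\mathcal{L}_y(\mathcal{U})$ and $\epsilon>0$ there exist $\chi^-_\epsilon(x,y),\chi^+_\epsilon(x,y)\in\mathbb{B}_{xy}(A)$ such that (1) $\chi^-_\epsilon(x,y)\subseteq(\psi(y)\wedge x=x)\subseteq\chi^+_\epsilon(x,y)$; (2) for every $\omega\in\operatorname{E}(\lambda,\mu)$, $\omega(\chi^+_\epsilon(x,y))-\omega(\chi^-_\epsilon(x,y))<\epsilon$; (3) for every $\omega\in\operatorname{E}(\lambda,\mu)$, $|\omega(\chi^{\dagger}_\epsilon(x,y))-\nu(\psi(y))|<\epsilon$ for $\dagger\in\{+,-\}$.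
   Context: For $B\subseteq\mathcal{U}$, $\mathcal{L}_x(B)$ is the Boolean algebra of formulas in $x$ with parameters from $B$ modulo $T$, identified with $B$-definable sets, and embedded in $\mathcal{L}_{xy}(B)$ via $\varphi(x)\mapsto\varphi(x)\wedge y=y$; $\mathfrak{M}_x(B)$ is the set of finitely additive probability measures on $\mathcal{L}_x(B)$. For $\omega\in\mathfrak{M}_{xy}(B)$, $\pi_x(\omega)(\varphi(x))=\omega(\varphi(x)\wedge y=y)$ (similarly $\pi_y$); $\omega|_C$ is restriction. $\operatorname{E}(\lambda,\mu)=\{\omega\in\mathfrak{M}_{xy}(\mathcal{U}):\omega|_A=\lambda,\pi_x(\omega)=\mu\}$. $\lambda$ witnesses $\mu\geq_{\mathbb{E},A}\nu$ means $\pi_x(\lambda)=\mu|_A$ and $\pi_y(\omega)=\nu$ for all $\omega\in\operatorname{E}(\lambda,\mu)$. $\mathbb{B}_{xy}(A)$ is the Boolean subalgebra of $\mathcal{L}_{xy}(\mathcal{U})$ generated by $\{\varphi(x)\wedge y=y:\varphi(x)\in\mathcal{L}_x(\mathcal{U})\}\cup\mathcal{L}_{xy}(A)$. -}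

module Defs where

open import Level using (Level; 0ℓ; _⊔_) renaming (suc to lsuc)
open import Data.Empty using (⊥; ⊥-elim)
open import Data.Fin.Base using (Fin)
open import Data.List.Base using (List)
open import Data.List.Relation.Unary.All using (All)
open import Data.Maybe.Base as Maybe using (Maybe; just; nothing; maybe′)
open import Data.Nat.Base using (ℕ)
open import Data.Product.Base using (Σ; ∃-syntax; _×_; _,_; proj₁; proj₂; map₂)
open import Data.Product.Function.NonDependent.Propositional using (_×-⇔_)
open import Data.Rational.Base as ℚ using (ℚ)
import Data.Rational.Properties as ℚ
open import Algebra.Properties.Group ℚ.+-0-group
  using () renaming (⁻¹-involutive to neg-involutive)
open import Data.Sum.Base as Sum using (_⊎_; inj₁; inj₂; [_,_]′)
open import Data.Sum.Function.Propositional using (_⊎-⇔_)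
open import Data.Unit.Base using (⊤; tt)
open import Data.Vec.Base as Vec using (Vec; []; _∷_)
open import Function.Base using (_∘_; id)
open import Function.Bundles using (_⇔_; mk⇔; Equivalence; Injection; _↔_; Inverse)
import Function.Construct.Identity as Id
open import Function.Related.TypeIsomorphisms using (¬-cong-⇔)
open import Relation.Binary.Bundles using (Poset; Setoid)
import Relation.Binary.Construct.On as On
open import Relation.Binary.Definitions using (tri<; tri≈; tri>)
open import Relation.Binary.PropositionalEquality
  using (_≡_; _≗_; refl; sym; trans; cong; cong₂; subst; setoid)
open import Relation.Nullary using (¬_)
open import Relation.Unary using (Pred; _∈_; _∉_; _⊆_; U)

-- The empty chain is included, so the hypothesis forces P to be inhabited.

ZornsLemma : ∀ p q r c → Set (lsuc (p ⊔ q ⊔ r ⊔ c))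
ZornsLemma p q r c =
  (P : Poset p q r) → let open Poset P in
  ((C : Pred Carrier c) →
     (∀ x y → x ∈ C → y ∈ C → x ≤ y ⊎ y ≤ x) →
     ∃[ b ] (∀ x → x ∈ C → x ≤ b)) →
  ∃[ m ] (∀ x → m ≤ x → x ≈ m)

-- Real numbers as Dedekind cuts.  A real is represented by its lower set
-- { q ∈ ℚ : q < x }; only the lower set is recorded, which gives the usual
-- real numbers under excluded middle.

record ℝ : Set₁ where
  field
    cut       : Pred ℚ 0ℓ
    inhabited : ∃[ q ] q ∈ cut
    bounded   : ∃[ q ] q ∉ cut
    downward  : ∀ {p q} → p ℚ.< q → q ∈ cut → p ∈ cut
    open′     : ∀ {p} → p ∈ cut → ∃[ q ] (p ℚ.< q × q ∈ cut)

open ℝ public using (cut)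

infix 4 _≈_ _≤_ _<_
infixl 6 _+_ _-_
infix 8 -_

_≤_ : ℝ → ℝ → Set
x ≤ y = cut x ⊆ cut y

_≈_ : ℝ → ℝ → Set
x ≈ y = x ≤ y × y ≤ x

_<_ : ℝ → ℝ → Set
x < y = ∃[ q ] (q ∈ cut y × q ∉ cut x)

private
  q-1<q : ∀ q → q ℚ.- ℚ.1ℚ ℚ.< q
  q-1<q q = subst (q ℚ.- ℚ.1ℚ ℚ.<_) (ℚ.+-identityʳ q)
    (ℚ.+-monoʳ-< q (ℚ.negative⁻¹ (ℚ.- ℚ.1ℚ)))

  -‿swap : ∀ {p q} → ℚ.- p ℚ.< q → ℚ.- q ℚ.< p
  -‿swap {p} {q} h =
    subst (ℚ.- q ℚ.<_) (neg-involutive p) (ℚ.neg-antimono-< h)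

  ∉-up : ∀ x {p q} → p ℚ.≤ q → p ∉ cut x → q ∉ cut x
  ∉-up x {p} {q} p≤q p∉ q∈ with ℚ.<-cmp p q
  ... | tri< p<q _ _  = p∉ (ℝ.downward x p<q q∈)
  ... | tri≈ _ refl _ = p∉ q∈
  ... | tri> _ _ q<p  = ⊥-elim (ℚ.<-irrefl refl (ℚ.<-≤-trans q<p p≤q))

  ∈∉⇒< : ∀ x {p q} → p ∈ cut x → q ∉ cut x → p ℚ.< q
  ∈∉⇒< x p∈ q∉ = ℚ.≰⇒> λ q≤p → ∉-up x q≤p q∉ p∈

fromℚ : ℚ → ℝ
fromℚ r = record
  { cut       = ℚ._< r
  ; inhabited = r ℚ.- ℚ.1ℚ , q-1<q r
  ; bounded   = r , ℚ.<-irrefl refl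
  ; downward  = ℚ.<-trans
  ; open′     = λ p<r → let q , p<q , q<r = ℚ.<-dense p<r in q , p<q , q<r
  }

0ℝ 1ℝ : ℝ
0ℝ = fromℚ ℚ.0ℚ
1ℝ = fromℚ ℚ.1ℚ

_+_ : ℝ → ℝ → ℝ
x + y = record
  { cut       = λ q → ∃[ r ] ∃[ s ] (r ∈ cut x × s ∈ cut y × q ℚ.< r ℚ.+ s)
  ; inhabited =
      let r , r∈ = ℝ.inhabited x ; s , s∈ = ℝ.inhabited y
      in (r ℚ.+ s) ℚ.- ℚ.1ℚ , r , s , r∈ , s∈ , q-1<q (r ℚ.+ s)
  ; bounded   =
      let b , b∉ = ℝ.bounded x ; c , c∉ = ℝ.bounded y
      in b ℚ.+ c , λ (r , s , r∈ , s∈ , lt) →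
           ℚ.<-asym lt (ℚ.+-mono-< (∈∉⇒< x r∈ b∉) (∈∉⇒< y s∈ c∉))
  ; downward  = λ { p<q (r , s , r∈ , s∈ , lt) → r , s , r∈ , s∈ , ℚ.<-trans p<q lt }
  ; open′     = λ (r , s , r∈ , s∈ , lt) →
      let q , p<q , q<rs = ℚ.<-dense lt in q , p<q , r , s , r∈ , s∈ , q<rs
  }

-- Requiring -r ∉ x for some r > q, and not merely -q ∉ x, keeps the lower set
-- open when x is rational.
-_ : ℝ → ℝ
- x = record
  { cut       = λ q → ∃[ r ] (q ℚ.< r × ℚ.- r ∉ cut x)
  ; inhabited =
      let b , b∉ = ℝ.bounded x
      in (ℚ.- b) ℚ.- ℚ.1ℚ , ℚ.- b , q-1<q (ℚ.- b)
         , subst (_∉ cut x) (sym (neg-involutive b)) b∉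
  ; bounded   =
      let a , a∈ = ℝ.inhabited x
      in ℚ.- a , λ (r , -a<r , -r∉) → -r∉ (ℝ.downward x (-‿swap -a<r) a∈)
  ; downward  = λ p<q (r , q<r , -r∉) → r , ℚ.<-trans p<q q<r , -r∉
  ; open′     = λ (r , p<r , -r∉) →
      let q , p<q , q<r = ℚ.<-dense p<r in q , p<q , r , q<r , -r∉
  }

_-_ : ℝ → ℝ → ℝ
x - y = x + (- y)

_⊔ℝ_ : ℝ → ℝ → ℝ
x ⊔ℝ y = record
  { cut       = λ q → q ∈ cut x ⊎ q ∈ cut y
  ; inhabited = map₂ inj₁ (ℝ.inhabited x)
  ; bounded   =
      let b , b∉ = ℝ.bounded x ; c , c∉ = ℝ.bounded y
      in b ℚ.⊔ c , [ ∉-up x (ℚ.p≤p⊔q b c) b∉ , ∉-up y (ℚ.p≤q⊔p b c) c∉ ]′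
  ; downward  = λ p<q → Sum.map (ℝ.downward x p<q) (ℝ.downward y p<q)
  ; open′     = [ (λ p∈ → let q , lt , q∈ = ℝ.open′ x p∈ in q , lt , inj₁ q∈)
                , (λ p∈ → let q , lt , q∈ = ℝ.open′ y p∈ in q , lt , inj₂ q∈) ]′
  }

∣_∣ : ℝ → ℝ
∣ x ∣ = x ⊔ℝ (- x)

record Language : Set₁ where
  field
    Fun : ℕ → Set
    Rel : ℕ → Set

open Language public

record Structure (𝓛 : Language) : Set₁ where
  field
    Carrier  : Set
    nonempty : Carrier
    fun      : ∀ {k} → Fun 𝓛 k → Vec Carrier k → Carrier
    rel      : ∀ {k} → Rel 𝓛 k → Vec Carrier k → Set

open Structure public

-- Terms and formulas have free variables in V and parameters (new constant
-- symbols) indexed by P.  A quantifier binds the variable `nothing`.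

data Term (𝓛 : Language) (P V : Set) : Set where
  var : V → Term 𝓛 P V
  par : P → Term 𝓛 P V
  app : ∀ {k} → Fun 𝓛 k → Vec (Term 𝓛 P V) k → Term 𝓛 P V

infix  9 _≐_
infix  8 ¬ᶠ_
infixr 7 _∧ᶠ_
infixr 6 _∨ᶠ_

data Formula (𝓛 : Language) (P V : Set) : Set where
  _≐_       : Term 𝓛 P V → Term 𝓛 P V → Formula 𝓛 P V
  atom      : ∀ {k} → Rel 𝓛 k → Vec (Term 𝓛 P V) k → Formula 𝓛 P V
  ⊤ᶠ ⊥ᶠ     : Formula 𝓛 P V
  ¬ᶠ_       : Formula 𝓛 P V → Formula 𝓛 P V
  _∧ᶠ_ _∨ᶠ_ : Formula 𝓛 P V → Formula 𝓛 P V → Formula 𝓛 P V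
  ∃ᶠ ∀ᶠ     : Formula 𝓛 P (Maybe V) → Formula 𝓛 P V

Sentence : Language → Set
Sentence 𝓛 = Formula 𝓛 ⊥ ⊥

module _ {𝓛 : Language} {P P′ V V′ : Set} (g : P → P′) (f : V → V′) where
  mapTerm  : Term 𝓛 P V → Term 𝓛 P′ V′
  mapTerms : ∀ {k} → Vec (Term 𝓛 P V) k → Vec (Term 𝓛 P′ V′) k
  mapTerm (var x)    = var (f x)
  mapTerm (par p)    = par (g p)
  mapTerm (app F ts) = app F (mapTerms ts)
  mapTerms []        = []
  mapTerms (t ∷ ts)  = mapTerm t ∷ mapTerms ts

mapFormula : ∀ {𝓛 P P′ V V′} → (P → P′) → (V → V′) →
             Formula 𝓛 P V → Formula 𝓛 P′ V′
mapFormula g f (s ≐ t)     = mapTerm g f s ≐ mapTerm g f t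
mapFormula g f (atom R ts) = atom R (mapTerms g f ts)
mapFormula g f ⊤ᶠ          = ⊤ᶠ
mapFormula g f ⊥ᶠ          = ⊥ᶠ
mapFormula g f (¬ᶠ φ)      = ¬ᶠ mapFormula g f φ
mapFormula g f (φ ∧ᶠ ψ)    = mapFormula g f φ ∧ᶠ mapFormula g f ψ
mapFormula g f (φ ∨ᶠ ψ)    = mapFormula g f φ ∨ᶠ mapFormula g f ψ
mapFormula g f (∃ᶠ φ)      = ∃ᶠ (mapFormula g (Maybe.map f) φ)
mapFormula g f (∀ᶠ φ)      = ∀ᶠ (mapFormula g (Maybe.map f) φ)

module _ {𝓛 : Language} (M : Structure 𝓛) where

  module _ {P V : Set} (ι : P → Carrier M) (ρ : V → Carrier M) where
    eval  : Term 𝓛 P V → Carrier M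
    evals : ∀ {k} → Vec (Term 𝓛 P V) k → Vec (Carrier M) k
    eval (var x)    = ρ x
    eval (par p)    = ι p
    eval (app F ts) = fun M F (evals ts)
    evals []        = []
    evals (t ∷ ts)  = eval t ∷ evals ts

  Sat : {P V : Set} → (P → Carrier M) → (V → Carrier M) → Formula 𝓛 P V → Set
  Sat ι ρ (s ≐ t)     = eval ι ρ s ≡ eval ι ρ t
  Sat ι ρ (atom R ts) = rel M R (evals ι ρ ts)
  Sat ι ρ ⊤ᶠ          = ⊤
  Sat ι ρ ⊥ᶠ          = ⊥
  Sat ι ρ (¬ᶠ φ)      = ¬ Sat ι ρ φ
  Sat ι ρ (φ ∧ᶠ ψ)    = Sat ι ρ φ × Sat ι ρ ψ
  Sat ι ρ (φ ∨ᶠ ψ)    = Sat ι ρ φ ⊎ Sat ι ρ ψ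
  Sat ι ρ (∃ᶠ φ)      = ∃[ u ] Sat ι (maybe′ ρ u) φ
  Sat ι ρ (∀ᶠ φ)      = ∀ u → Sat ι (maybe′ ρ u) φ

  module _ {P P′ : Set} {ι : P → Carrier M} {ι′ : P′ → Carrier M}
           {g : P → P′} (ι≗ : ι′ ∘ g ≗ ι) where

    module _ {V V′ : Set} {ρ : V → Carrier M} {ρ′ : V′ → Carrier M}
             {f : V → V′} (ρ≗ : ρ′ ∘ f ≗ ρ) where
      eval-map  : ∀ t → eval ι′ ρ′ (mapTerm g f t) ≡ eval ι ρ t
      evals-map : ∀ {k} (ts : Vec _ k) →
                  evals ι′ ρ′ (mapTerms g f ts) ≡ evals ι ρ ts
      eval-map (var x)    = ρ≗ x
      eval-map (par p)    = ι≗ p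
      eval-map (app F ts) = cong (fun M F) (evals-map ts)
      evals-map []        = refl
      evals-map (t ∷ ts)  = cong₂ _∷_ (eval-map t) (evals-map ts)

    maybe-map : ∀ {V V′ : Set} {ρ : V → Carrier M} {ρ′ : V′ → Carrier M}
                {f : V → V′} → ρ′ ∘ f ≗ ρ →
                ∀ u → maybe′ ρ′ u ∘ Maybe.map f ≗ maybe′ ρ u
    maybe-map ρ≗ u (just x) = ρ≗ x
    maybe-map ρ≗ u nothing  = refl

    Sat-map : ∀ {V V′ : Set} {ρ : V → Carrier M} {ρ′ : V′ → Carrier M}
              {f : V → V′} → ρ′ ∘ f ≗ ρ → (φ : Formula 𝓛 P V) →
              Sat ι′ ρ′ (mapFormula g f φ) ⇔ Sat ι ρ φ
    Sat-map ρ≗ (s ≐ t) = mk⇔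
      (λ e → trans (sym (eval-map ρ≗ s)) (trans e (eval-map ρ≗ t)))
      (λ e → trans (eval-map ρ≗ s) (trans e (sym (eval-map ρ≗ t))))
    Sat-map ρ≗ (atom R ts) = mk⇔
      (subst (rel M R) (evals-map ρ≗ ts))
      (subst (rel M R) (sym (evals-map ρ≗ ts)))
    Sat-map ρ≗ ⊤ᶠ       = Id.⇔-id _
    Sat-map ρ≗ ⊥ᶠ       = Id.⇔-id _
    Sat-map ρ≗ (¬ᶠ φ)   = ¬-cong-⇔ (Sat-map ρ≗ φ)
    Sat-map ρ≗ (φ ∧ᶠ ψ) = Sat-map ρ≗ φ ×-⇔ Sat-map ρ≗ ψ
    Sat-map ρ≗ (φ ∨ᶠ ψ) = Sat-map ρ≗ φ ⊎-⇔ Sat-map ρ≗ ψ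
    Sat-map ρ≗ (∃ᶠ φ)   = mk⇔
      (λ (u , s) → u , Equivalence.to   (Sat-map (maybe-map ρ≗ u) φ) s)
      (λ (u , s) → u , Equivalence.from (Sat-map (maybe-map ρ≗ u) φ) s)
    Sat-map ρ≗ (∀ᶠ φ)   = mk⇔
      (λ s u → Equivalence.to   (Sat-map (maybe-map ρ≗ u) φ) (s u))
      (λ s u → Equivalence.from (Sat-map (maybe-map ρ≗ u) φ) (s u))

Theory : Language → Set₁
Theory 𝓛 = Pred (Sentence 𝓛) 0ℓ

_⊨_ : ∀ {𝓛} → Structure 𝓛 → Sentence 𝓛 → Set
M ⊨ σ = Sat M ⊥-elim ⊥-elim σ

_⊨ₜ_ : ∀ {𝓛} → Structure 𝓛 → Theory 𝓛 → Set
M ⊨ₜ T = ∀ {σ} → σ ∈ T → M ⊨ σ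

_⊩_ : ∀ {𝓛} → Theory 𝓛 → Sentence 𝓛 → Set₁
T ⊩ σ = ∀ M → M ⊨ₜ T → M ⊨ σ

record IsComplete {𝓛} (T : Theory 𝓛) : Set₁ where
  field
    satisfiable : ∃[ M ] M ⊨ₜ T
    decides     : ∀ σ → T ⊩ σ ⊎ T ⊩ (¬ᶠ σ)

infix 4 _≺_

-- |S| < |S′|
_≺_ : Setoid 0ℓ 0ℓ → Setoid 0ℓ 0ℓ → Set
S ≺ S′ = Injection S S′ × ¬ Injection S′ S

-- Elements of Σ X B are compared by first component only, so that B counts as
-- a subset of X even when membership proofs are not unique.
subset : {X : Set} → Pred X 0ℓ → Setoid 0ℓ 0ℓ
subset {X} B = On.setoid {B = Σ X B} (setoid X) proj₁

module _ {𝓛 : Language} (𝒰 : Structure 𝓛) where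

  -- Formulas in the tuple of variables V with parameters from B ⊆ 𝒰.
  ℒ : Pred (Carrier 𝒰) 0ℓ → Set → Set
  ℒ B V = Formula 𝓛 (Σ (Carrier 𝒰) B) V

  ⟦_⟧ : ∀ {B V} → ℒ B V → Pred (V → Carrier 𝒰) 0ℓ
  ⟦ φ ⟧ ρ = Sat 𝒰 proj₁ ρ φ

  -- A cardinal is represented by a set κ of that cardinality.
  Small : Set → Pred (Carrier 𝒰) 0ℓ → Set
  Small κ B = subset B ≺ setoid κ

  Saturated : Set → Set₁
  Saturated κ =
    (B : Pred (Carrier 𝒰) 0ℓ) → Small κ B →
    (p : Pred (ℒ B ⊤) 0ℓ) →
    ((Δ : List (ℒ B ⊤)) → All (_∈ p) Δ → ∃[ u ] All (λ φ → ⟦ φ ⟧ (λ _ → u)) Δ) →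
    ∃[ u ] (∀ φ → φ ∈ p → ⟦ φ ⟧ (λ _ → u))

  record Automorphism : Set where
    field
      bijection : Carrier 𝒰 ↔ Carrier 𝒰
    open Inverse bijection public using (to)
    field
      fun-preserved : ∀ {k} (F : Fun 𝓛 k) us →
                      to (fun 𝒰 F us) ≡ fun 𝒰 F (Vec.map to us)
      rel-preserved : ∀ {k} (R : Rel 𝓛 k) us →
                      rel 𝒰 R us ⇔ rel 𝒰 R (Vec.map to us)

  -- h : B → 𝒰 is partial elementary: reinterpreting each parameter b as h b
  -- does not change the truth of sentences over B.
  Elementary : {B : Pred (Carrier 𝒰) 0ℓ} → (Σ (Carrier 𝒰) B → Carrier 𝒰) → Set
  Elementary {B} h =
    (σ : ℒ B ⊥) → Sat 𝒰 proj₁ ⊥-elim σ ⇔ Sat 𝒰 h ⊥-elim σ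

  StronglyHomogeneous : Set → Set₁
  StronglyHomogeneous κ =
    (B : Pred (Carrier 𝒰) 0ℓ) → Small κ B →
    (h : Σ (Carrier 𝒰) B → Carrier 𝒰) → Elementary h →
    ∃[ σ ] (∀ b → Automorphism.to σ (proj₁ b) ≡ h b)

  -- κ is only required to exceed the number of sentences; no further condition
  -- such as being a strong limit is imposed.
  record IsMonster (κ : Set) (T : Theory 𝓛) : Set₁ where
    field
      models      : 𝒰 ⊨ₜ T
      large       : setoid (Sentence 𝓛) ≺ setoid κ
      saturated   : Saturated κ
      homogeneous : StronglyHomogeneous κ

  -- An element of the Boolean algebra ℒ_V(B) is represented by a formula; two
  -- formulas are identified when they define the same set.

  infix 4 _⊑_ _∼_

  _⊑_ : ∀ {B C V} → ℒ B V → ℒ C V → Set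
  φ ⊑ ψ = ⟦ φ ⟧ ⊆ ⟦ ψ ⟧

  _∼_ : ∀ {B C V} → ℒ B V → ℒ C V → Set
  φ ∼ ψ = φ ⊑ ψ × ψ ⊑ φ

  record 𝔐 (B : Pred (Carrier 𝒰) 0ℓ) (V : Set) : Set₁ where
    field
      measure     : ℒ B V → ℝ
      respects    : ∀ {φ ψ} → φ ∼ ψ → measure φ ≈ measure ψ
      nonnegative : ∀ φ → 0ℝ ≤ measure φ
      total       : measure ⊤ᶠ ≈ 1ℝ
      additive    : ∀ {φ ψ} → φ ∧ᶠ ψ ∼ ⊥ᶠ {P = Σ (Carrier 𝒰) B} →
                    measure (φ ∨ᶠ ψ) ≈ measure φ + measure ψ

  open 𝔐 public

  infix 4 _≋_

  _≋_ : ∀ {B V} → 𝔐 B V → 𝔐 B V → Set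
  μ ≋ ν = ∀ φ → measure μ φ ≈ measure ν φ

  module _ {B C : Pred (Carrier 𝒰) 0ℓ} {V W : Set}
           (B⊆C : B ⊆ C) (f : V → W) where

    embed : ℒ B V → ℒ C W
    embed = mapFormula (map₂ B⊆C) f

    embed-⟦⟧ : ∀ φ ρ → ⟦ embed φ ⟧ ρ ⇔ ⟦ φ ⟧ (ρ ∘ f)
    embed-⟦⟧ φ ρ = Sat-map 𝒰 (λ _ → refl) (λ _ → refl) φ

    embed-⊑ : ∀ {φ ψ} → φ ⊑ ψ → embed φ ⊑ embed ψ
    embed-⊑ {φ} {ψ} φ⊑ψ {ρ} =
      Equivalence.from (embed-⟦⟧ ψ ρ) ∘ φ⊑ψ ∘ Equivalence.to (embed-⟦⟧ φ ρ)

    pullback : 𝔐 C W → 𝔐 B V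
    pullback ω = record
      { measure     = measure ω ∘ embed
      ; respects    = λ {φ} {ψ} (φ⊑ψ , ψ⊑φ) →
          respects ω (embed-⊑ {φ} {ψ} φ⊑ψ , embed-⊑ {ψ} {φ} ψ⊑φ)
      ; nonnegative = nonnegative ω ∘ embed
      ; total       = total ω
      ; additive    = λ {φ} {ψ} (disj , _) →
          additive ω (embed-⊑ {φ ∧ᶠ ψ} {⊥ᶠ} disj , ⊥-elim)
      }

  -- The image of φ(x) in ℒ_xy.  Formulas are taken in a declared context of
  -- variables, so the conjunct y = y is not needed; likewise for ψ(y).
  _↑ˣ : ∀ {B X Y} → ℒ B X → ℒ B (X ⊎ Y)
  _↑ˣ = embed id inj₁

  _↑ʸ : ∀ {B X Y} → ℒ B Y → ℒ B (X ⊎ Y)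
  _↑ʸ = embed id inj₂

  πˣ : ∀ {B X Y} → 𝔐 B (X ⊎ Y) → 𝔐 B X
  πˣ = pullback id inj₁

  πʸ : ∀ {B X Y} → 𝔐 B (X ⊎ Y) → 𝔐 B Y
  πʸ = pullback id inj₂

  -- Below, U is the full subset, so that ℒ U and 𝔐 U have parameters from
  -- all of 𝒰.
  _↿_ : ∀ {V} → 𝔐 U V → (A : Pred (Carrier 𝒰) 0ℓ) → 𝔐 A V
  ω ↿ A = pullback (λ _ → tt) id ω

  module _ {A : Pred (Carrier 𝒰) 0ℓ} {X Y : Set} where

    E : 𝔐 A (X ⊎ Y) → 𝔐 U X → Pred (𝔐 U (X ⊎ Y)) 0ℓ
    E λ′ μ ω = (ω ↿ A) ≋ λ′ × πˣ ω ≋ μ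

    -- λ′ witnesses μ ≥_{𝔼,A} ν
    Witnesses : 𝔐 A (X ⊎ Y) → 𝔐 U X → 𝔐 U Y → Set₁
    Witnesses λ′ μ ν = πˣ λ′ ≋ (μ ↿ A) × (∀ ω → ω ∈ E λ′ μ → πʸ ω ≋ ν)

  data 𝔹 (A : Pred (Carrier 𝒰) 0ℓ) {X Y : Set} : Pred (ℒ U (X ⊎ Y)) 0ℓ where
    from-x    : (φ : ℒ U X) → 𝔹 A (φ ↑ˣ)
    from-A    : (θ : ℒ A (X ⊎ Y)) → 𝔹 A (embed (λ _ → tt) id θ)
    ⊤-closed  : 𝔹 A ⊤ᶠ
    ⊥-closed  : 𝔹 A ⊥ᶠ
    ¬-closed  : ∀ {φ} → 𝔹 A φ → 𝔹 A (¬ᶠ φ)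
    ∧-closed  : ∀ {φ ψ} → 𝔹 A φ → 𝔹 A ψ → 𝔹 A (φ ∧ᶠ ψ)
    ∨-closed  : ∀ {φ ψ} → 𝔹 A φ → 𝔹 A ψ → 𝔹 A (φ ∨ᶠ ψ)
    respectsᴮ : ∀ {φ ψ} → φ ∼ ψ → 𝔹 A φ → 𝔹 A ψ

{-# OPTIONS --safe #-}

-- For a finite F ⊆ 𝔹 let χ⁺ be the union of the atoms of F that meet ψ, and χ⁻
-- the complement of the union of those that meet ¬ψ.  If no F works uniformly in
-- ω ∈ E(λ, μ), each F has a bad ω_F.  Move the ω_F-mass of each atom of F to one
-- point of it, in ψ whenever possible: the result still agrees with ω_F on F and
-- gives ψ the mass ω_F(χ⁺).  With ¬ψ in place of ψ, it gives ¬ψ the mass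
-- 1 - ω_F(χ⁻).  The limits along an ultrafilter containing all {F : φ ∈ F} lie in
-- E(λ, μ) and differ by at least ε on ψ, although both give ψ the mass ν(ψ).

module Submission where

open import Defs
open import Algebra.Bundles using (AbelianGroup)
import Algebra.Properties.AbelianGroup as AbelianGroupProperties
import Algebra.Properties.CommutativeSemigroup as CommutativeSemigroupProperties
open import Axiom.ExcludedMiddle using (ExcludedMiddle)
open import Data.Empty using (⊥; ⊥-elim)
open import Data.Fin.Base using (Fin)
open import Data.Integer.Base as ℤ using (+_; -[1+_])
import Data.Integer.Properties as ℤ
open import Data.List.Base using (List; []; _∷_; _++_; map)
open import Data.List.Membership.Propositional using () renaming (_∈_ to _∈ᴸ_)
open import Data.List.Membership.Propositional.Properties using (∈-++⁺ˡ; ∈-++⁺ʳ; ∈-map⁺)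
open import Data.List.Relation.Binary.Subset.Propositional using () renaming (_⊆_ to _⊆ᴸ_)
open import Data.List.Relation.Unary.Any using (here; there)
open import Data.Nat.Base as ℕ using (ℕ; zero; suc)
open import Data.Product.Base using (Σ; _×_; ∃-syntax; _,_; proj₁; proj₂; swap)
open import Data.Rational.Base as ℚ using (ℚ; mkℚ; toℚᵘ; fromℚᵘ)
import Data.Rational.Properties as ℚ
open import Data.Rational.Solver using (module +-*-Solver)
open import Data.Rational.Unnormalised.Base as ℚᵘ using (mkℚᵘ; *≡*; *≤*)
import Data.Rational.Unnormalised.Properties as ℚᵘ
open import Data.Sum.Base using (_⊎_; inj₁; inj₂; [_,_]′)
open import Function.Base using (_∘_; id)
open import Level using (0ℓ)
open import Relation.Binary.Bundles using (Poset)
open import Relation.Binary.Definitions using (tri<; tri≈; tri>)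
open import Relation.Binary.PropositionalEquality as ≡
  using (_≡_; refl; cong; subst; subst₂)
open import Relation.Nullary using (¬_; Dec; yes; no)
open import Relation.Nullary.Decidable using (decidable-stable; True; toWitness; fromWitness; from-yes)
open import Relation.Unary using (Pred; _∈_; _∉_; _⊆_; _∩_; ∁; U)

open +-*-Solver using (solve; _:=_; _:+_; _:*_; :-_; con; _:-_)

-- Rational arithmetic: the Archimedean property and halving.

fromNat : ℕ → ℚ
fromNat n = fromℚᵘ (mkℚᵘ (+ n) 0)

fromNat-suc : ∀ n → fromNat (suc n) ≡ ℚ.1ℚ ℚ.+ fromNat n
fromNat-suc n = ℚ.toℚᵘ-injective (begin
  toℚᵘ (fromNat (suc n))              ≈⟨ ℚ.toℚᵘ-fromℚᵘ (mkℚᵘ (+ suc n) 0) ⟩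
  mkℚᵘ (+ suc n) 0                    ≈⟨ *≡* (cong (ℤ._* + 1) (cong (λ k → + 1 ℤ.+ k) (≡.sym (ℤ.*-identityʳ (+ n))))) ⟩
  toℚᵘ ℚ.1ℚ ℚᵘ.+ mkℚᵘ (+ n) 0         ≈⟨ ℚᵘ.+-congʳ (toℚᵘ ℚ.1ℚ) (ℚ.toℚᵘ-fromℚᵘ (mkℚᵘ (+ n) 0)) ⟨
  toℚᵘ ℚ.1ℚ ℚᵘ.+ toℚᵘ (fromNat n)     ≈⟨ ℚ.toℚᵘ-homo-+ ℚ.1ℚ (fromNat n) ⟨
  toℚᵘ (ℚ.1ℚ ℚ.+ fromNat n)           ∎)
  where open ℚᵘ.≃-Reasoning

≤fromNat : ∀ q → ∃[ n ] q ℚ.≤ fromNat n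
≤fromNat q@(mkℚ (+ k) d-1 _) = k , ℚ.toℚᵘ-cancel-≤
  (ℚᵘ.≤-respʳ-≃ (ℚᵘ.≃-sym (ℚ.toℚᵘ-fromℚᵘ (mkℚᵘ (+ k) 0)))
    (*≤* (ℤ.*-monoˡ-≤-nonNeg (+ k) (ℤ.+≤+ (ℕ.s≤s ℕ.z≤n)))))
≤fromNat q@(mkℚ -[1+ k ] _ _) = 0 , ℚ.nonPositive⁻¹ q

archimedean : ∀ {δ} → ℚ.0ℚ ℚ.< δ → ∀ q → ∃[ n ] q ℚ.≤ fromNat n ℚ.* δ
archimedean {δ} 0<δ q =
  let instance
        pos = ℚ.positive 0<δ
        nz  = ℚ.pos⇒nonZero δ
        nn  = ℚ.pos⇒nonNeg δ
      n , le = ≤fromNat (q ℚ.* ℚ.1/ δ)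
  in n , subst (ℚ._≤ fromNat n ℚ.* δ)
           (≡.trans (ℚ.*-assoc q (ℚ.1/ δ) δ)
             (≡.trans (cong (q ℚ.*_) (ℚ.*-inverseˡ δ)) (ℚ.*-identityʳ q)))
           (ℚ.*-monoʳ-≤-nonNeg δ le)

half : ∀ {ε} → ℚ.0ℚ ℚ.< ε → ∃[ δ ] (ℚ.0ℚ ℚ.< δ × δ ℚ.+ δ ≡ ε)
half {ε} 0<ε = ℚ.½ ℚ.* ε
  , subst (ℚ._< ℚ.½ ℚ.* ε) (ℚ.*-zeroʳ ℚ.½) (ℚ.*-monoʳ-<-pos ℚ.½ 0<ε)
  , solve 1 (λ e → con ℚ.½ :* e :+ con ℚ.½ :* e := e) refl ε

<-sub : ∀ {p q} → p ℚ.< q → ℚ.0ℚ ℚ.< q ℚ.- p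
<-sub {p} {q} p<q = subst (ℚ._< q ℚ.- p) (ℚ.+-inverseʳ p) (ℚ.+-monoˡ-< (ℚ.- p) p<q)

-- Order and addition of Dedekind cuts.

-- The order of Defs unfolds to an inclusion of cuts, from which Agda cannot
-- recover its two sides; this wrapper keeps them inferable.
infix 4 _≼_ _≃_

record _≼_ (x y : ℝ) : Set where
  constructor ⟨_⟩
  field incl : x ≤ y

open _≼_

_≃_ : ℝ → ℝ → Set
x ≃ y = x ≼ y × y ≼ x

≼-refl : ∀ {x} → x ≼ x
≼-refl = ⟨ id ⟩

≼-trans : ∀ {x y z} → x ≼ y → y ≼ z → x ≼ z
≼-trans x≼y y≼z = ⟨ incl y≼z ∘ incl x≼y ⟩

≃-trans : ∀ {x y z} → x ≃ y → y ≃ z → x ≃ z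
≃-trans (p , p′) (q , q′) = ≼-trans p q , ≼-trans q′ p′

fromℝ≈ : ∀ {x y} → x ≈ y → x ≃ y
fromℝ≈ (x≤y , y≤x) = ⟨ x≤y ⟩ , ⟨ y≤x ⟩

toℝ≈ : ∀ {x y} → x ≃ y → x ≈ y
toℝ≈ (x≼y , y≼x) = incl x≼y , incl y≼x

cut-down : ∀ x {p q} → p ℚ.≤ q → q ∈ cut x → p ∈ cut x
cut-down x {p} {q} p≤q q∈ with ℚ.<-cmp p q
... | tri< p<q _ _  = ℝ.downward x p<q q∈
... | tri≈ _ refl _ = q∈
... | tri> _ _ q<p  = ⊥-elim (ℚ.<-irrefl refl (ℚ.<-≤-trans q<p p≤q))

cut-below : ∀ x {p q} → p ∈ cut x → q ∉ cut x → p ℚ.< q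
cut-below x p∈ q∉ = ℚ.≰⇒> λ q≤p → q∉ (cut-down x q≤p p∈)

-- The sum of Defs unfolds to a record of cuts and proofs, which makes
-- unification compare those proofs; the opaque copies avoid this.
infixl 6 _⊕_
infix 8 ⊖_

opaque
  _⊕_ : ℝ → ℝ → ℝ
  _⊕_ = _+_

  ⊖_ : ℝ → ℝ
  ⊖_ = -_

  ⊕-mono : ∀ {x x′ y y′} → x ≼ x′ → y ≼ y′ → x ⊕ y ≼ x′ ⊕ y′
  ⊕-mono x≼x′ y≼y′ = ⟨ (λ (r , s , r∈ , s∈ , lt) → r , s , incl x≼x′ r∈ , incl y≼y′ s∈ , lt) ⟩

  ⊕-comm-≼ : ∀ x y → x ⊕ y ≼ y ⊕ x
  ⊕-comm-≼ x y = ⟨ (λ {q} (r , s , r∈ , s∈ , lt) → s , r , s∈ , r∈ , subst (q ℚ.<_) (ℚ.+-comm r s) lt) ⟩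

  ⊕-assoc-≼ : ∀ x y z → (x ⊕ y) ⊕ z ≼ x ⊕ (y ⊕ z)
  ⊕-assoc-≼ x y z = ⟨ (λ {q} (r , s , (a , b , a∈ , b∈ , r<ab) , s∈ , q<rs) →
    -- Members of a sum lie strictly below a sum of members, so `b` is raised to `b′` to place
    -- `b + s` in `y ⊕ z`.
    let b′ , b<b′ , b′∈ = ℝ.open′ y b∈
    in a , b ℚ.+ s , a∈ , (b′ , s , b′∈ , s∈ , ℚ.+-monoˡ-< s b<b′)
     , ℚ.<-trans q<rs (subst (r ℚ.+ s ℚ.<_) (ℚ.+-assoc a b s) (ℚ.+-monoˡ-< s r<ab))) ⟩

  ⊕-identityˡ : ∀ x → 0ℝ ⊕ x ≃ x
  ⊕-identityˡ x =
      ⟨ (λ {q} (r , s , r<0 , s∈ , lt) →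
          ℝ.downward x (ℚ.<-trans lt (subst (r ℚ.+ s ℚ.<_) (ℚ.+-identityˡ s) (ℚ.+-monoˡ-< s r<0))) s∈) ⟩
    , ⟨ (λ {q} q∈ →
          -- The first raise makes `q - q′` negative, the second makes `(q - q′) + q″` exceed `q`
          -- strictly.
          let q′ , q<q′ , q′∈ = ℝ.open′ x q∈
              q″ , q′<q″ , q″∈ = ℝ.open′ x q′∈
          in q ℚ.- q′ , q″
           , subst (q ℚ.- q′ ℚ.<_) (ℚ.+-inverseʳ q′) (ℚ.+-monoˡ-< (ℚ.- q′) q<q′)
           , q″∈
           , subst (ℚ._< (q ℚ.- q′) ℚ.+ q″)
               (solve 2 (λ a b → (a :- b) :+ b := a) refl q q′)
               (ℚ.+-monoʳ-< (q ℚ.- q′) q′<q″)) ⟩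

  ⊖-antimono : ∀ {x y} → x ≼ y → ⊖ y ≼ ⊖ x
  ⊖-antimono x≼y = ⟨ (λ (r , q<r , -r∉) → r , q<r , -r∉ ∘ incl x≼y) ⟩

  ⊖x⊕x≼0 : ∀ x → (⊖ x) ⊕ x ≼ 0ℝ
  ⊖x⊕x≼0 x = ⟨ (λ {q} (r , s , (t , r<t , -t∉) , s∈ , lt) →
    ℚ.<-trans lt (subst (r ℚ.+ s ℚ.<_) (ℚ.+-inverseʳ t)
      (ℚ.+-mono-< r<t (cut-below x s∈ -t∉)))) ⟩

  -- The rational 1 separates the two sides: it is not below itself, but it is below `q″ + (1 - q′)`
  -- for rationals `0 < q′ < q″` in the cut of `ε`.
  ε⊕1⋠1 : ∀ {ε} → 0ℝ < ε → ¬ (ε ⊕ 1ℝ ≼ 1ℝ)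
  ε⊕1⋠1 {ε} (q , q∈ , q≮0) h =
    let q′ , q<q′ , q′∈ = ℝ.open′ ε q∈
        q″ , q′<q″ , q″∈ = ℝ.open′ ε q′∈
        0<q′ = ℚ.≤-<-trans (ℚ.≮⇒≥ q≮0) q<q′
    in ℚ.<-irrefl refl (incl h {ℚ.1ℚ}
         ( q″ , ℚ.1ℚ ℚ.- q′ , q″∈
         , subst (ℚ.1ℚ ℚ.- q′ ℚ.<_) (ℚ.+-identityʳ ℚ.1ℚ)
             (ℚ.+-monoʳ-< ℚ.1ℚ (ℚ.neg-antimono-< 0<q′))
         , subst (ℚ._< q″ ℚ.+ (ℚ.1ℚ ℚ.- q′))
             (solve 1 (λ a → a :+ (con ℚ.1ℚ :- a) := con ℚ.1ℚ) refl q′)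
             (ℚ.+-monoˡ-< (ℚ.1ℚ ℚ.- q′) q′<q″)))

  toℝ≈+ : ∀ {x y z} → x ≃ y ⊕ z → x ≈ y + z
  toℝ≈+ {x} {y} {z} = toℝ≈ {x} {y + z}

  fromℝ≈+ : ∀ {x y z} → x ≈ y + z → x ≃ y ⊕ z
  fromℝ≈+ {x} {y} {z} = fromℝ≈ {x} {y + z}

⊕-assoc-≽ : ∀ x y z → x ⊕ (y ⊕ z) ≼ (x ⊕ y) ⊕ z
⊕-assoc-≽ x y z =
  ≼-trans (⊕-comm-≼ x (y ⊕ z)) (≼-trans (⊕-assoc-≼ y z x)
  (≼-trans (⊕-comm-≼ y (z ⊕ x)) (≼-trans (⊕-assoc-≼ z x y) (⊕-comm-≼ z (x ⊕ y)))))

-- Classical real arithmetic: the additive group and estimates.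

module Classical (em : ∀ {ℓ} → ExcludedMiddle ℓ) where

  -- Steps of length `δ` from a member of the cut pass an upper bound after finitely many moves, by
  -- the Archimedean property; the last point still inside serves as `r`.
  cut-approx : ∀ x {δ} → ℚ.0ℚ ℚ.< δ → ∃[ r ] (r ∈ cut x × (r ℚ.+ δ) ∉ cut x)
  cut-approx x {δ} 0<δ =
    let a , a∈ = ℝ.inhabited x
        b , b∉ = ℝ.bounded x
        n , le = archimedean 0<δ (b ℚ.- a)
    in search n a a∈ λ h → b∉ (cut-down x
         (subst (ℚ._≤ a ℚ.+ fromNat n ℚ.* δ)
           (solve 2 (λ a b → a :+ (b :- a) := b) refl a b)
           (ℚ.+-monoʳ-≤ a le)) h)
    where
    search : ∀ n r → r ∈ cut x → (r ℚ.+ fromNat n ℚ.* δ) ∉ cut x →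
             ∃[ r ] (r ∈ cut x × (r ℚ.+ δ) ∉ cut x)
    search zero r r∈ ∉x = ⊥-elim (∉x (subst (_∈ cut x)
      (≡.sym (≡.trans (cong (r ℚ.+_) (ℚ.*-zeroˡ δ)) (ℚ.+-identityʳ r))) r∈))
    search (suc n) r r∈ ∉x with em {P = (r ℚ.+ δ) ∈ cut x}
    ... | no  ∉x′ = r , r∈ , ∉x′
    ... | yes ∈x  = search n (r ℚ.+ δ) ∈x (subst (_∉ cut x)
      (≡.trans (cong (λ k → r ℚ.+ k ℚ.* δ) (fromNat-suc n))
        (solve 3 (λ r k d → r :+ (con ℚ.1ℚ :+ k) :* d := (r :+ d) :+ k :* d) refl r (fromNat n) δ))
      ∉x)

  opaque
    unfolding _⊕_ ⊖_

    0≼⊖x⊕x : ∀ x → 0ℝ ≼ (⊖ x) ⊕ x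
    0≼⊖x⊕x x = ⟨ (λ {q} q<0 →
      -- With `2δ = -q`, the number `-(s + δ)` exceeds `q - s` by `δ`. Any `r` between them lies in
      -- the cut of `⊖ x`, and `r + s` exceeds `q`.
      let δ , 0<δ , 2δ≡-q = half (subst (ℚ._< ℚ.- q) refl (ℚ.neg-antimono-< q<0))
          s , s∈ , s+δ∉ = cut-approx x 0<δ
          q-s<t : q ℚ.- s ℚ.< ℚ.- (s ℚ.+ δ)
          q-s<t = subst₂ ℚ._<_
            (≡.trans (solve 2 (λ s d → (:- (s :+ d)) :+ (:- d) := :- (d :+ d) :- s) refl s δ)
              (≡.trans (cong (λ k → ℚ.- k ℚ.- s) 2δ≡-q)
                (solve 2 (λ q s → :- (:- q) :- s := q :- s) refl q s)))
            (ℚ.+-identityʳ (ℚ.- (s ℚ.+ δ)))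
            (ℚ.+-monoʳ-< (ℚ.- (s ℚ.+ δ)) (ℚ.neg-antimono-< 0<δ))
          r , q-s<r , r<t = ℚ.<-dense q-s<t
      in r , s
       , (ℚ.- (s ℚ.+ δ) , r<t
         , subst (_∉ cut x) (solve 1 (λ a → a := :- (:- a)) refl (s ℚ.+ δ)) s+δ∉)
       , s∈
       , subst (ℚ._< r ℚ.+ s) (solve 2 (λ q s → (q :- s) :+ s := q) refl q s)
           (ℚ.+-monoˡ-< s q-s<r)) ⟩

  ⊕-abelianGroup : AbelianGroup _ _
  ⊕-abelianGroup = record
    { Carrier = ℝ
    ; _≈_ = _≃_
    ; _∙_ = _⊕_
    ; ε = 0ℝ
    ; _⁻¹ = ⊖_
    ; isAbelianGroup = record
      { isGroup = record
        { isMonoid = record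
          { isSemigroup = record
            { isMagma = record
              { isEquivalence = record
                { refl  = ≼-refl , ≼-refl
                ; sym   = swap
                ; trans = ≃-trans
                }
              ; ∙-cong = λ (p , p′) (q , q′) → ⊕-mono p q , ⊕-mono p′ q′
              }
            ; assoc = λ x y z → ⊕-assoc-≼ x y z , ⊕-assoc-≽ x y z
            }
          ; identity = ⊕-identityˡ , λ x → ≃-trans (⊕-comm x 0ℝ) (⊕-identityˡ x)
          }
        ; inverse = ⊖x⊕x≃0 , λ x → ≃-trans (⊕-comm x (⊖ x)) (⊖x⊕x≃0 x)
        ; ⁻¹-cong = λ (p , p′) → ⊖-antimono p′ , ⊖-antimono p
        }
      ; comm = ⊕-comm
      }
    }
    where
    ⊕-comm : ∀ x y → x ⊕ y ≃ y ⊕ x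
    ⊕-comm x y = ⊕-comm-≼ x y , ⊕-comm-≼ y x

    ⊖x⊕x≃0 : ∀ x → (⊖ x) ⊕ x ≃ 0ℝ
    ⊖x⊕x≃0 x = ⊖x⊕x≼0 x , 0≼⊖x⊕x x

  open AbelianGroup ⊕-abelianGroup public
    using ()
    renaming ( refl to ≃-refl; sym to ≃-sym; ∙-cong to ⊕-cong
             ; identityʳ to ⊕-identityʳ; commutativeSemigroup to ⊕-commutativeSemigroup)
  open AbelianGroupProperties ⊕-abelianGroup public
    using (//-rightDividesˡ; identityʳ-unique; ⁻¹-anti-homo‿-)
  open CommutativeSemigroupProperties ⊕-commutativeSemigroup public using (interchange)

  ≼-<-trans : ∀ x y z → x ≼ y → y < z → x < z
  ≼-<-trans _ _ _ x≼y (q , q∈ , q∉) = q , q∈ , q∉ ∘ incl x≼y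

  <-⊔ : ∀ x y z → x < z → y < z → (x ⊔ℝ y) < z
  <-⊔ x y z (p , p∈ , p∉) (q , q∈ , q∉) with ℚ.≤-total p q
  ... | inj₁ p≤q = q , q∈ , [ p∉ ∘ cut-down x p≤q , q∉ ]′
  ... | inj₂ q≤p = p , p∈ , [ p∉ , q∉ ∘ cut-down y q≤p ]′

  opaque
    unfolding _⊕_ ⊖_

    -- Both `x` and `c` lie between `b` and `a`, so neither of their two differences exceeds
    -- `a - b`.
    ∣-∣<-within : ∀ a b c x ε → b ≼ c → c ≼ a → b ≼ x → x ≼ a → a - b < ε → ∣ x - c ∣ < ε
    ∣-∣<-within a b c x ε b≼c c≼a b≼x x≼a a-b<ε = <-⊔ (x - c) (- (x - c)) ε
      (≼-<-trans (x - c) (a - b) ε x-c≼ a-b<ε)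
      (≼-<-trans (- (x - c)) (a - b) ε c-x≼ a-b<ε)
      where
      x-c≼ : x ⊕ (⊖ c) ≼ a ⊕ (⊖ b)
      x-c≼ = ⊕-mono {x} {a} {⊖ c} {⊖ b} x≼a (⊖-antimono b≼c)

      c-x≼ : ⊖ (x ⊕ (⊖ c)) ≼ a ⊕ (⊖ b)
      c-x≼ = ≼-trans {⊖ (x ⊕ (⊖ c))} {c ⊕ (⊖ x)} {a ⊕ (⊖ b)} (proj₁ (⁻¹-anti-homo‿- x c))
        (⊕-mono {c} {a} {⊖ x} {⊖ b} c≼a (⊖-antimono b≼x))

    ≮⇒≽ : ∀ a b ε → ¬ (a - b < ε) → ε ≼ a ⊕ (⊖ b)
    ≮⇒≽ a b ε ≮ = ⟨ (λ {q} q∈ → decidable-stable em λ q∉ → ≮ (q , q∈ , q∉)) ⟩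

  ≮⇒⊕-≼ : ∀ {a b ε} → ¬ (a - b < ε) → ε ⊕ b ≼ a
  ≮⇒⊕-≼ {a} {b} {ε} ≮ =
    ≼-trans (⊕-mono (≮⇒≽ a b ε ≮) ≼-refl) (proj₁ (//-rightDividesˡ b a))

  x≼x⊕y : ∀ x {y} → 0ℝ ≼ y → x ≼ x ⊕ y
  x≼x⊕y x 0≼y = ≼-trans (proj₂ (⊕-identityʳ x)) (⊕-mono ≼-refl 0≼y)

  -- The union of a chain of filters lives one universe too high, and is
  -- brought down by excluded middle.
  Resize : ∀ {ℓ} → Set ℓ → Set
  Resize P = True (em {P = P})

  resize : ∀ {ℓ} {P : Set ℓ} → P → Resize P
  resize = fromWitness

  unresize : ∀ {ℓ} {P : Set ℓ} → Resize P → P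
  unresize = toWitness

-- Filters, and ultrafilters from Zorn's lemma.

record Filter (I : Set) : Set₁ where
  field
    large  : Pred (Pred I 0ℓ) 0ℓ
    top    : U ∈ large
    upward : ∀ {S T} → S ⊆ T → S ∈ large → T ∈ large
    meet   : ∀ {S T} → S ∈ large → T ∈ large → S ∩ T ∈ large
    proper : ∀ {S} → S ∈ large → ∃[ i ] i ∈ S

open Filter

IsUltra : {I : Set} → Filter I → Set₁
IsUltra 𝓕 = ∀ S → S ∈ large 𝓕 ⊎ ∁ S ∈ large 𝓕

-- The filter of tails for inclusion of finite lists. For each element it contains the set of lists
-- that mention it, so a limit along a finer ultrafilter sees every element.
eventually : {X : Set} → Filter (List X)
eventually = record
    { large  = λ S → ∃[ F ] (∀ {G} → F ⊆ᴸ G → G ∈ S)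
    ; top    = [] , _
    ; upward = λ S⊆T (F , h) → F , S⊆T ∘ h
    ; meet   = λ (F , h) (G , k) → F ++ G
        , λ F++G⊆ → h (F++G⊆ ∘ ∈-++⁺ˡ) , k (F++G⊆ ∘ ∈-++⁺ʳ F)
    ; proper = λ (F , h) → F , h id
    }

module Ultrafilters (em : ∀ {ℓ} → ExcludedMiddle ℓ)
                    (zorn : ∀ {p q r c} → ZornsLemma p q r c) where
  open Classical em

  module _ {I : Set} where

    -- The filter generated by `𝓕` and `S`. If an empty `T` were large in it, the implication from
    -- `S` to `T` would make `∁ S` large in `𝓕`.
    adjoin : (𝓕 : Filter I) (S : Pred I 0ℓ) → ∁ S ∉ large 𝓕 → Filter I
    adjoin 𝓕 S ∁S∉ = record
      { large  = λ T → (λ i → i ∈ S → i ∈ T) ∈ large 𝓕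
      ; top    = upward 𝓕 _ (top 𝓕)
      ; upward = λ T⊆T′ → upward 𝓕 (λ h → T⊆T′ ∘ h)
      ; meet   = λ T∈ T′∈ → upward 𝓕 (λ (h , k) s → h s , k s) (meet 𝓕 T∈ T′∈)
      ; proper = λ T∈ → decidable-stable em λ none →
          ∁S∉ (upward 𝓕 (λ h s → none (_ , h s)) T∈)
      }

    Above : Filter I → Set₁
    Above 𝓕 = Σ (Filter I) λ 𝓖 → large 𝓕 ⊆ large 𝓖

    above : Filter I → Poset _ _ _
    above 𝓕 = record
      { Carrier = Above 𝓕
      ; _≈_ = λ (𝓖 , _) (𝓗 , _) → large 𝓖 ⊆ large 𝓗 × large 𝓗 ⊆ large 𝓖
      ; _≤_ = λ (𝓖 , _) (𝓗 , _) → large 𝓖 ⊆ large 𝓗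
      ; isPartialOrder = record
        { isPreorder = record
          { isEquivalence = record
            { refl  = id , id
            ; sym   = swap
            ; trans = λ (p , p′) (q , q′) → q ∘ p , p′ ∘ q′
            }
          ; reflexive = proj₁
          ; trans = λ p q → q ∘ p
          }
        ; antisym = _,_
        }
      }

    chain-bound : (𝓕 : Filter I) (C : Pred (Above 𝓕) 0ℓ) →
      (∀ x y → x ∈ C → y ∈ C → large (proj₁ x) ⊆ large (proj₁ y) ⊎ large (proj₁ y) ⊆ large (proj₁ x)) →
      Σ (Above 𝓕) λ b → ∀ x → x ∈ C → large (proj₁ x) ⊆ large (proj₁ b)
    chain-bound 𝓕 C chain with em {P = Σ (Above 𝓕) C}
    -- The union of an empty chain would lack the full set; `𝓕` itself is the bound.
    ... | no  empty = (𝓕 , id) , λ x x∈C → ⊥-elim (empty (x , x∈C))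
    ... | yes (x₀@(𝓖₀ , 𝓕⊆𝓖₀) , x₀∈C) = (⋃C , λ S∈ → resize (x₀ , x₀∈C , 𝓕⊆𝓖₀ S∈))
                                       , λ x x∈C S∈ → resize (x , x∈C , S∈)
      where
      In : Pred I 0ℓ → Set₁
      In S = Σ (Above 𝓕) λ x → x ∈ C × S ∈ large (proj₁ x)

      In-meet : ∀ {S T} → In S → In T → In (S ∩ T)
      In-meet (x , x∈C , S∈) (y , y∈C , T∈) with chain x y x∈C y∈C
      ... | inj₁ x⊆y = y , y∈C , meet (proj₁ y) (x⊆y S∈) T∈
      ... | inj₂ y⊆x = x , x∈C , meet (proj₁ x) S∈ (y⊆x T∈)

      ⋃C : Filter I
      ⋃C = record
        { large  = λ S → Resize (In S)
        ; top    = resize (x₀ , x₀∈C , top 𝓖₀)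
        ; upward = λ S⊆T S∈ → let x , x∈C , S∈x = unresize {P = In _} S∈
                              in resize (x , x∈C , upward (proj₁ x) S⊆T S∈x)
        ; meet   = λ S∈ T∈ → resize (In-meet (unresize {P = In _} S∈) (unresize {P = In _} T∈))
        ; proper = λ S∈ → let x , _ , S∈x = unresize {P = In _} S∈
                          in proper (proj₁ x) S∈x
        }

    ultrafilter : (𝓕 : Filter I) → ∃[ 𝓖 ] (large 𝓕 ⊆ large 𝓖 × IsUltra 𝓖)
    ultrafilter 𝓕 with zorn (above 𝓕) (chain-bound 𝓕)
    ... | (𝓖 , 𝓕⊆𝓖) , maximal = 𝓖 , 𝓕⊆𝓖 , ultra
      where
      ultra : IsUltra 𝓖
      ultra S with em {P = ∁ S ∈ large 𝓖}
      ... | yes ∁S∈ = inj₂ ∁S∈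
      -- By maximality, every set of the filter generated by `𝓖` and `S` is already in `𝓖`; one of
      -- them is `S`.
      ... | no  ∁S∉ = inj₁ (proj₁ (maximal
        (adjoin 𝓖 S ∁S∉ , upward 𝓖 (λ t _ → t) ∘ 𝓕⊆𝓖)
        (upward 𝓖 (λ t _ → t))) (upward 𝓖 (λ _ → id) (top 𝓖)))

-- Limits of nets in the unit interval along an ultrafilter.

record Net (I : Set) : Set₁ where
  field
    at       : I → ℝ
    nonneg   : ∀ i → 0ℝ ≼ at i
    at-most1 : ∀ i → at i ≼ 1ℝ

open Net

module Limit (em : ∀ {ℓ} → ExcludedMiddle ℓ)
             {I : Set} (𝓕 : Filter I) (ultra : IsUltra 𝓕) where
  open Classical em

  opaque
    unfolding _⊕_

    -- The strict step from `q` to `q′` makes the cut open; the bounds 0 and 1 on the net make it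
    -- inhabited and bounded.
    lim : Net I → ℝ
    lim f = record
      { cut       = λ q → ∃[ q′ ] (q ℚ.< q′ × (λ i → q′ ∈ cut (at f i)) ∈ large 𝓕)
      ; inhabited = ℚ.- ℚ.1ℚ ℚ.- ℚ.1ℚ , ℚ.- ℚ.1ℚ , from-yes (ℚ.- ℚ.1ℚ ℚ.- ℚ.1ℚ ℚ.<? ℚ.- ℚ.1ℚ)
                  , upward 𝓕 (λ {i} _ → incl (nonneg f i) (from-yes (ℚ.- ℚ.1ℚ ℚ.<? ℚ.0ℚ))) (top 𝓕)
      ; bounded   = ℚ.1ℚ , λ (q , 1<q , q∈) → let i , q∈fi = proper 𝓕 q∈
                                              in ℚ.<-asym 1<q (incl (at-most1 f i) q∈fi)
      ; downward  = λ p<q (q′ , q<q′ , q′∈) → q′ , ℚ.<-trans p<q q<q′ , q′∈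
      ; open′     = λ (q′ , p<q′ , q′∈) →
          let q , p<q , q<q′ = ℚ.<-dense p<q′ in q , p<q , q′ , q<q′ , q′∈
      }

    lim-≼ : ∀ f {x} → (λ i → at f i ≼ x) ∈ large 𝓕 → lim f ≼ x
    lim-≼ f {x} f≼x = ⟨ (λ (q′ , q<q′ , q′∈) →
      let i , q′∈fi , fi≼x = proper 𝓕 (meet 𝓕 q′∈ f≼x)
      in ℝ.downward x q<q′ (incl fi≼x q′∈fi)) ⟩

    lim-≽ : ∀ f {x} → (λ i → x ≼ at f i) ∈ large 𝓕 → x ≼ lim f
    lim-≽ f {x} x≼f = ⟨ (λ q∈ →
      let q′ , q<q′ , q′∈ = ℝ.open′ x q∈
      in q′ , q<q′ , upward 𝓕 (λ x≼fi → incl x≼fi q′∈) x≼f) ⟩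

    lim-mono : ∀ f g → (∀ i → at f i ≼ at g i) → lim f ≼ lim g
    lim-mono f g f≼g = ⟨ (λ (q′ , q<q′ , q′∈) →
      q′ , q<q′ , upward 𝓕 (λ {i} → incl (f≼g i)) q′∈) ⟩

    -- The ultrafilter dichotomy: `q` is in the cuts of almost all values or outside almost all of
    -- them, and the former would put `p` in the cut of the limit.
    lim-∉ : ∀ f {p q} → p ℚ.< q → p ∉ cut (lim f) → (λ i → q ∉ cut (at f i)) ∈ large 𝓕
    lim-∉ f {q = q} p<q p∉ with ultra (λ i → q ∈ cut (at f i))
    ... | inj₁ q∈ = ⊥-elim (p∉ (q , p<q , q∈))
    ... | inj₂ q∉ = q∉

    lim-⊕-∈ : ∀ g h {q q′} → q ℚ.< q′ → (λ i → q′ ∈ cut (at g i ⊕ at h i)) ∈ large 𝓕 →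
              q ∈ cut (lim g ⊕ lim h)
    lim-⊕-∈ g h {q} {q′} q<q′ q′∈ =
      -- The excess `q′ - q` is `2δ`. Each limit is approximated within `η`, half of `δ`, and the
      -- other half is the strict room that `lim-∉` asks for. A common index then gives
      -- `q′ < r + s + 2δ`.
      let δ , 0<δ , 2δ≡ = half (<-sub q<q′)
          η , 0<η , 2η≡ = half 0<δ
          r , r∈ , r+η∉ = cut-approx (lim g) 0<η
          s , s∈ , s+η∉ = cut-approx (lim h) 0<η
          bump : ∀ t → t ℚ.+ η ℚ.< t ℚ.+ δ
          bump t = ℚ.+-monoʳ-< t (subst (η ℚ.<_) 2η≡
            (subst (ℚ._< η ℚ.+ η) (ℚ.+-identityʳ η) (ℚ.+-monoʳ-< η 0<η)))
          i , (a , b , a∈ , b∈ , q′<a+b) , r+δ∉ , s+δ∉ = proper 𝓕 (meet 𝓕 q′∈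
            (meet 𝓕 (lim-∉ g (bump r) r+η∉) (lim-∉ h (bump s) s+η∉)))
          q′<r+s+2δ : q′ ℚ.< (r ℚ.+ δ) ℚ.+ (s ℚ.+ δ)
          q′<r+s+2δ = ℚ.<-trans q′<a+b
            (ℚ.+-mono-< (cut-below (at g i) a∈ r+δ∉) (cut-below (at h i) b∈ s+δ∉))
      in r , s , r∈ , s∈
       , subst₂ ℚ._<_
           (solve 2 (λ q q′ → q′ :- (q′ :- q) := q) refl q q′)
           (≡.trans (cong (λ k → (r ℚ.+ δ) ℚ.+ (s ℚ.+ δ) ℚ.- k) (≡.sym 2δ≡))
             (solve 3 (λ r s d → (r :+ d) :+ (s :+ d) :- (d :+ d) := r :+ s) refl r s δ))
           (ℚ.+-monoˡ-< (ℚ.- (q′ ℚ.- q)) q′<r+s+2δ)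

    ≼-lim-⊕ : ∀ g h {x} → (∀ i → x ≼ at g i ⊕ at h i) → x ≼ lim g ⊕ lim h
    ≼-lim-⊕ g h {x} x≼g⊕h = ⟨ (λ q∈ →
      let q′ , q<q′ , q′∈ = ℝ.open′ x q∈
      in lim-⊕-∈ g h q<q′ (upward 𝓕 (λ {i} _ → incl (x≼g⊕h i) q′∈) (top 𝓕))) ⟩

    lim-⊕-≼ : ∀ f g h → (∀ i → at f i ≼ at g i ⊕ at h i) → lim f ≼ lim g ⊕ lim h
    lim-⊕-≼ f g h f≼g⊕h = ⟨ (λ (q′ , q<q′ , q′∈) →
      lim-⊕-∈ g h q<q′ (upward 𝓕 (λ {i} → incl (f≼g⊕h i)) q′∈)) ⟩

    lim-⊕-≽ : ∀ f g h → (∀ i → at g i ⊕ at h i ≼ at f i) → lim g ⊕ lim h ≼ lim f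
    lim-⊕-≽ f g h g⊕h≼f = ⟨ (λ (r , s , (r′ , r<r′ , r′∈) , (s′ , s<s′ , s′∈) , q<r+s) →
      r ℚ.+ s , q<r+s
      , upward 𝓕 (λ {i} (r′∈gi , s′∈hi) →
          incl (g⊕h≼f i) (r′ , s′ , r′∈gi , s′∈hi , ℚ.+-mono-< r<r′ s<s′))
          (meet 𝓕 r′∈ s′∈)) ⟩

  lim-≃ : ∀ f {x} → (λ i → at f i ≃ x) ∈ large 𝓕 → lim f ≃ x
  lim-≃ f f≃x = lim-≼ f (upward 𝓕 proj₁ f≃x) , lim-≽ f (upward 𝓕 proj₂ f≃x)

  lim-cong : ∀ f g → (∀ i → at f i ≃ at g i) → lim f ≃ lim g
  lim-cong f g f≃g = lim-mono f g (proj₁ ∘ f≃g) , lim-mono g f (proj₂ ∘ f≃g)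

  lim-⊕ : ∀ f g h → (∀ i → at f i ≃ at g i ⊕ at h i) → lim f ≃ lim g ⊕ lim h
  lim-⊕ f g h f≃g⊕h = lim-⊕-≼ f g h (proj₁ ∘ f≃g⊕h) , lim-⊕-≽ f g h (proj₂ ∘ f≃g⊕h)

-- Measures on formulas and their ultralimits.

module Measures (em : ∀ {ℓ} → ExcludedMiddle ℓ) {𝓛 : Language} (𝒰 : Structure 𝓛)
                {B : Pred (Carrier 𝒰) 0ℓ} {V : Set} where
  open Classical em

  Fm : Set
  Fm = ℒ 𝒰 B V

  Val : Set
  Val = V → Carrier 𝒰

  infix 4 _⊨ᵥ_ _⊑′_

  _⊨ᵥ_ : Val → Fm → Set
  ρ ⊨ᵥ φ = Sat 𝒰 proj₁ ρ φ

  _⊑′_ : Fm → Fm → Set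
  φ ⊑′ ψ = ∀ ρ → ρ ⊨ᵥ φ → ρ ⊨ᵥ ψ

  module _ (ω : 𝔐 𝒰 B V) where

    measure-cong : ∀ φ ψ → φ ⊑′ ψ → ψ ⊑′ φ → measure ω φ ≃ measure ω ψ
    measure-cong φ ψ φ⊑ψ ψ⊑φ = fromℝ≈ (respects ω {φ} {ψ} (φ⊑ψ _ , ψ⊑φ _))

    measure-∨ : ∀ φ ψ → (∀ ρ → ρ ⊨ᵥ φ → ¬ ρ ⊨ᵥ ψ) →
                measure ω (φ ∨ᶠ ψ) ≃ measure ω φ ⊕ measure ω ψ
    measure-∨ φ ψ disj = fromℝ≈+ (additive ω {φ} {ψ} ((λ {ρ} (h , k) → disj ρ h k) , ⊥-elim))

    -- An empty formula is disjoint from itself, so its measure equals its own double and cancels to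
    -- 0.
    measure-empty : ∀ φ → (∀ ρ → ¬ ρ ⊨ᵥ φ) → measure ω φ ≃ 0ℝ
    measure-empty φ empty = identityʳ-unique (measure ω φ) (measure ω φ)
      (≃-trans (≃-sym (measure-∨ φ φ (λ ρ h _ → empty ρ h)))
               (measure-cong (φ ∨ᶠ φ) φ (λ _ → [ id , id ]′) (λ _ → inj₁)))

    measure-split : ∀ φ ψ → measure ω φ ≃ measure ω (φ ∧ᶠ ψ) ⊕ measure ω (φ ∧ᶠ ¬ᶠ ψ)
    measure-split φ ψ = ≃-trans
      (measure-cong φ ((φ ∧ᶠ ψ) ∨ᶠ (φ ∧ᶠ ¬ᶠ ψ)) cases (λ _ → [ proj₁ , proj₁ ]′))
      (measure-∨ (φ ∧ᶠ ψ) (φ ∧ᶠ ¬ᶠ ψ) (λ _ (_ , h) (_ , ¬h) → ¬h h))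
      where
      cases : φ ⊑′ (φ ∧ᶠ ψ) ∨ᶠ (φ ∧ᶠ ¬ᶠ ψ)
      cases ρ h with em {P = ρ ⊨ᵥ ψ}
      ... | yes k = inj₁ (h , k)
      ... | no ¬k = inj₂ (h , ¬k)

    measure-mono : ∀ φ ψ → φ ⊑′ ψ → measure ω φ ≼ measure ω ψ
    measure-mono φ ψ φ⊑ψ = ≼-trans
      (proj₁ (measure-cong φ (ψ ∧ᶠ φ) (λ ρ h → φ⊑ψ ρ h , h) (λ _ → proj₂)))
      (≼-trans (x≼x⊕y (measure ω (ψ ∧ᶠ φ)) ⟨ nonnegative ω (ψ ∧ᶠ ¬ᶠ φ) ⟩)
               (proj₂ (measure-split ψ φ)))

    measure-⊤ : measure ω ⊤ᶠ ≃ 1ℝ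
    measure-⊤ = fromℝ≈ (total ω)

    measure-¬ : ∀ φ → 1ℝ ≃ measure ω φ ⊕ measure ω (¬ᶠ φ)
    measure-¬ φ = ≃-trans (≃-sym measure-⊤) (≃-trans (measure-split ⊤ᶠ φ)
      (⊕-cong (measure-cong (⊤ᶠ ∧ᶠ φ) φ (λ _ → proj₂) (λ _ h → _ , h))
              (measure-cong (⊤ᶠ ∧ᶠ ¬ᶠ φ) (¬ᶠ φ) (λ _ → proj₂) (λ _ h → _ , h))))

    measure≼1 : ∀ φ → measure ω φ ≼ 1ℝ
    measure≼1 φ = ≼-trans (measure-mono φ ⊤ᶠ _) (proj₁ measure-⊤)

  module _ {I : Set} (𝓕 : Filter I) (ultra : IsUltra 𝓕) (ω : I → 𝔐 𝒰 B V) where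
    open Limit em 𝓕 ultra

    net : Fm → Net I
    net φ = record
      { at       = λ i → measure (ω i) φ
      ; nonneg   = λ i → ⟨ nonnegative (ω i) φ ⟩
      ; at-most1 = λ i → measure≼1 (ω i) φ
      }

    ultralimit : 𝔐 𝒰 B V
    ultralimit = record
      { measure     = lim ∘ net
      ; respects    = λ {φ} {ψ} (φ⊑ψ , ψ⊑φ) → toℝ≈ (lim-cong (net φ) (net ψ)
          λ i → measure-cong (ω i) φ ψ (λ _ → φ⊑ψ) (λ _ → ψ⊑φ))
      ; nonnegative = λ φ → incl (lim-≽ (net φ) (upward 𝓕 (λ {i} _ → nonneg (net φ) i) (top 𝓕)))
      ; total       = toℝ≈ (lim-≃ (net ⊤ᶠ) (upward 𝓕 (λ {i} _ → measure-⊤ (ω i)) (top 𝓕)))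
      ; additive    = λ {φ} {ψ} (disj , _) → toℝ≈+ (lim-⊕ (net (φ ∨ᶠ ψ)) (net φ) (net ψ)
          λ i → measure-∨ (ω i) φ ψ (λ _ h k → disj (h , k)))
      }

  -- Replacing the atoms of a finite family by point masses.

  weigh : {P : Set} → Dec P → ℝ → ℝ
  weigh (yes _) x = x
  weigh (no _)  x = 0ℝ

  weigh-nonneg : ∀ {P x} (d : Dec P) → 0ℝ ≼ x → 0ℝ ≼ weigh d x
  weigh-nonneg (yes _) 0≼x = 0≼x
  weigh-nonneg (no _)  _   = ≼-refl

  weigh-cong : ∀ {P Q x} (d : Dec P) (e : Dec Q) → (P → Q) → (Q → P) → weigh d x ≃ weigh e x
  weigh-cong (yes _) (yes _) _   _   = ≃-refl
  weigh-cong (yes p) (no ¬q) P→Q _   = ⊥-elim (¬q (P→Q p))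
  weigh-cong (no ¬p) (yes q) _   Q→P = ⊥-elim (¬p (Q→P q))
  weigh-cong (no _)  (no _)  _   _   = ≃-refl

  weigh-⊎ : ∀ {P Q x} (d : Dec P) (e : Dec Q) (f : Dec (P ⊎ Q)) → (P → ¬ Q) →
            weigh f x ≃ weigh d x ⊕ weigh e x
  weigh-⊎         (yes p) (yes q) _       P→¬Q = ⊥-elim (P→¬Q p q)
  weigh-⊎ {x = x} (yes _) (no _)  (yes _) _    = ≃-sym (⊕-identityʳ x)
  weigh-⊎ {x = x} (no _)  (yes _) (yes _) _    = ≃-sym (⊕-identityˡ x)
  weigh-⊎         (no _)  (no _)  (no _)  _    = ≃-sym (⊕-identityˡ 0ℝ)
  weigh-⊎         (yes p) _       (no ¬f) _    = ⊥-elim (¬f (inj₁ p))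
  weigh-⊎         _       (yes q) (no ¬f) _    = ⊥-elim (¬f (inj₂ q))
  weigh-⊎         (no ¬p) (no ¬q) (yes f) _    = ⊥-elim ([ ¬p , ¬q ]′ f)

  module Discretize (ω : 𝔐 𝒰 B V) (pick : Fm → Val)
                    (pick-⊨ : ∀ c ρ → ρ ⊨ᵥ c → pick c ⊨ᵥ c) where

    -- The point picked in `c` fails `c` only when `c` is unsatisfiable, so atoms without a genuine
    -- point carry no mass.
    unpicked-null : ∀ c → ¬ pick c ⊨ᵥ c → measure ω c ≃ 0ℝ
    unpicked-null c ∉c = measure-empty ω c λ ρ h → ∉c (pick-⊨ c ρ h)

    -- mass F c moves the ω-mass of each atom of c cut out by F to the point picked in it.
    mass : List Fm → Fm → Fm → ℝ
    mass []      c θ = weigh (em {P = pick c ⊨ᵥ θ}) (measure ω c)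
    mass (φ ∷ F) c θ = mass F (c ∧ᶠ φ) θ ⊕ mass F (c ∧ᶠ ¬ᶠ φ) θ

    mass-nonneg : ∀ F c θ → 0ℝ ≼ mass F c θ
    mass-nonneg []      c θ = weigh-nonneg (em {P = pick c ⊨ᵥ θ}) ⟨ nonnegative ω c ⟩
    mass-nonneg (φ ∷ F) c θ = ≼-trans (mass-nonneg F (c ∧ᶠ φ) θ)
      (x≼x⊕y _ (mass-nonneg F (c ∧ᶠ ¬ᶠ φ) θ))

    mass-cong : ∀ F c θ θ′ → θ ⊑′ θ′ → θ′ ⊑′ θ → mass F c θ ≃ mass F c θ′
    mass-cong []      c θ θ′ p q = weigh-cong em em (p _) (q _)
    mass-cong (φ ∷ F) c θ θ′ p q = ⊕-cong (mass-cong F (c ∧ᶠ φ) θ θ′ p q)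
                                          (mass-cong F (c ∧ᶠ ¬ᶠ φ) θ θ′ p q)

    mass-∨ : ∀ F c θ θ′ → (∀ ρ → ρ ⊨ᵥ θ → ¬ ρ ⊨ᵥ θ′) →
             mass F c (θ ∨ᶠ θ′) ≃ mass F c θ ⊕ mass F c θ′
    mass-∨ []      c θ θ′ disj = weigh-⊎ em em em (disj _)
    mass-∨ (φ ∷ F) c θ θ′ disj = ≃-trans
      (⊕-cong (mass-∨ F (c ∧ᶠ φ) θ θ′ disj) (mass-∨ F (c ∧ᶠ ¬ᶠ φ) θ θ′ disj))
      (interchange _ _ _ _)

    mass-inside : ∀ F c θ → c ⊑′ θ → mass F c θ ≃ measure ω c
    mass-inside [] c θ c⊑θ with em {P = pick c ⊨ᵥ θ}
    ... | yes _ = ≃-refl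
    ... | no ∉θ = ≃-sym (unpicked-null c (∉θ ∘ c⊑θ _))
    mass-inside (φ ∷ F) c θ c⊑θ = ≃-trans
      (⊕-cong (mass-inside F (c ∧ᶠ φ) θ (λ ρ → c⊑θ ρ ∘ proj₁))
              (mass-inside F (c ∧ᶠ ¬ᶠ φ) θ (λ ρ → c⊑θ ρ ∘ proj₁)))
      (≃-sym (measure-split ω c φ))

    mass-outside : ∀ F c θ → c ⊑′ ¬ᶠ θ → mass F c θ ≃ 0ℝ
    mass-outside [] c θ c⊑¬θ with em {P = pick c ⊨ᵥ θ}
    ... | yes ∈θ = unpicked-null c λ ∈c → c⊑¬θ _ ∈c ∈θ
    ... | no _   = ≃-refl
    mass-outside (φ ∷ F) c θ c⊑¬θ = ≃-trans
      (⊕-cong (mass-outside F (c ∧ᶠ φ) θ (λ ρ → c⊑¬θ ρ ∘ proj₁))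
              (mass-outside F (c ∧ᶠ ¬ᶠ φ) θ (λ ρ → c⊑¬θ ρ ∘ proj₁)))
      (⊕-identityˡ 0ℝ)

    -- At the position of `φ` in `F`, all atoms of `c ∧ᶠ φ` lie inside `φ` and all atoms of
    -- `c ∧ᶠ ¬ᶠ φ` outside, whichever points are picked; earlier members only split both sides.
    mass-agrees : ∀ {F φ} → φ ∈ᴸ F → ∀ c → mass F c φ ≃ measure ω (c ∧ᶠ φ)
    mass-agrees {φ ∷ F} (here refl) c = ≃-trans
      (⊕-cong (mass-inside F (c ∧ᶠ φ) φ (λ _ → proj₂))
              (mass-outside F (c ∧ᶠ ¬ᶠ φ) φ (λ _ → proj₂)))
      (⊕-identityʳ _)
    mass-agrees {χ ∷ F} {φ} (there φ∈F) c = ≃-trans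
      (⊕-cong
        (≃-trans (mass-agrees φ∈F (c ∧ᶠ χ))
          (measure-cong ω ((c ∧ᶠ χ) ∧ᶠ φ) ((c ∧ᶠ φ) ∧ᶠ χ) swap₂ swap₂))
        (≃-trans (mass-agrees φ∈F (c ∧ᶠ ¬ᶠ χ))
          (measure-cong ω ((c ∧ᶠ ¬ᶠ χ) ∧ᶠ φ) ((c ∧ᶠ φ) ∧ᶠ ¬ᶠ χ) swap₂ swap₂)))
      (≃-sym (measure-split ω (c ∧ᶠ φ) χ))
      where
      swap₂ : {P Q R : Val → Set} → ∀ ρ → (P ρ × Q ρ) × R ρ → (P ρ × R ρ) × Q ρ
      swap₂ _ ((p , q) , r) = (p , r) , q

    discretize : List Fm → 𝔐 𝒰 B V
    discretize F = record
      { measure     = mass F ⊤ᶠ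
      ; respects    = λ {φ} {ψ} (p , q) → toℝ≈ (mass-cong F ⊤ᶠ φ ψ (λ _ → p) (λ _ → q))
      ; nonnegative = λ φ → incl (mass-nonneg F ⊤ᶠ φ)
      ; total       = toℝ≈ (≃-trans (mass-inside F ⊤ᶠ ⊤ᶠ (λ _ → id)) (measure-⊤ ω))
      ; additive    = λ {φ} {ψ} (disj , _) →
          toℝ≈+ (mass-∨ F ⊤ᶠ φ ψ (λ _ h k → disj (h , k)))
      }

    discretize-agrees : ∀ {F φ} → φ ∈ᴸ F → measure (discretize F) φ ≃ measure ω φ
    discretize-agrees {F} {φ} φ∈F = ≃-trans (mass-agrees φ∈F ⊤ᶠ)
      (measure-cong ω (⊤ᶠ ∧ᶠ φ) φ (λ _ → proj₂) (λ _ h → _ , h))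

  -- Outer approximation of a formula by atoms.

  module Outer (ψ : Fm) where

    -- The decision is an argument so that proofs can generalise over it and match on it.
    keep : {P : Set} → Dec P → Fm → Fm
    keep (yes _) c = c
    keep (no _)  c = ⊥ᶠ

    -- The least union of atoms of `F` inside `c` that covers `c ∧ᶠ ψ`.
    outer : List Fm → Fm → Fm
    outer []      c = keep (em {P = ∃[ ρ ] ρ ⊨ᵥ (c ∧ᶠ ψ)}) c
    outer (φ ∷ F) c = outer F (c ∧ᶠ φ) ∨ᶠ outer F (c ∧ᶠ ¬ᶠ φ)

    outer-⊑ : ∀ F c → outer F c ⊑′ c
    outer-⊑ [] c ρ h with em {P = ∃[ ρ ] ρ ⊨ᵥ (c ∧ᶠ ψ)}
    ... | yes _ = h
    ... | no _  = ⊥-elim h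
    outer-⊑ (φ ∷ F) c ρ (inj₁ h) = proj₁ (outer-⊑ F (c ∧ᶠ φ) ρ h)
    outer-⊑ (φ ∷ F) c ρ (inj₂ h) = proj₁ (outer-⊑ F (c ∧ᶠ ¬ᶠ φ) ρ h)

    ⊑-outer : ∀ F c → c ∧ᶠ ψ ⊑′ outer F c
    ⊑-outer [] c ρ (h , k) with em {P = ∃[ ρ ] ρ ⊨ᵥ (c ∧ᶠ ψ)}
    ... | yes _   = h
    ... | no none = none (ρ , h , k)
    ⊑-outer (φ ∷ F) c ρ (h , k) with em {P = ρ ⊨ᵥ φ}
    ... | yes l = inj₁ (⊑-outer F (c ∧ᶠ φ) ρ ((h , l) , k))
    ... | no ¬l = inj₂ (⊑-outer F (c ∧ᶠ ¬ᶠ φ) ρ ((h , ¬l) , k))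

    -- The preference for points of `ψ` gives `ψ` as much mass as the atoms allow.
    pick : Fm → Val
    pick c with em {P = ∃[ ρ ] ρ ⊨ᵥ (c ∧ᶠ ψ)} | em {P = ∃[ ρ ] ρ ⊨ᵥ c}
    ... | yes (ρ , _) | _           = ρ
    ... | no _        | yes (ρ , _) = ρ
    -- Only an unsatisfiable `c` arrives here, so any valuation will do.
    ... | no _        | no _        = λ _ → nonempty 𝒰

    pick-⊨ : ∀ c ρ → ρ ⊨ᵥ c → pick c ⊨ᵥ c
    pick-⊨ c ρ h with em {P = ∃[ ρ ] ρ ⊨ᵥ (c ∧ᶠ ψ)} | em {P = ∃[ ρ ] ρ ⊨ᵥ c}
    ... | yes (_ , k , _) | _           = k
    ... | no _            | yes (_ , k) = k
    ... | no _            | no none     = ⊥-elim (none (ρ , h))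

    pick-⊨ψ : ∀ c → ∃[ ρ ] ρ ⊨ᵥ (c ∧ᶠ ψ) → pick c ⊨ᵥ ψ
    pick-⊨ψ c some with em {P = ∃[ ρ ] ρ ⊨ᵥ (c ∧ᶠ ψ)} | em {P = ∃[ ρ ] ρ ⊨ᵥ c}
    ... | yes (_ , _ , k) | _ = k
    ... | no none         | _ = ⊥-elim (none some)

    module _ (ω : 𝔐 𝒰 B V) where
      open Discretize ω pick pick-⊨

      -- Each atom counts fully or not at all: if it meets `ψ`, its point lies in `ψ` and the atom
      -- is kept; otherwise it contributes 0 and is dropped.
      mass-outer : ∀ F c → mass F c ψ ≃ measure ω (outer F c)
      mass-outer [] c = mass-keep em
        where
        mass-keep : ∀ d → mass [] c ψ ≃ measure ω (keep {P = ∃[ ρ ] ρ ⊨ᵥ (c ∧ᶠ ψ)} d c)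
        -- The measure of `c` is read as `weigh (yes some)` of itself, so that two decisions can be
        -- compared.
        mass-keep (yes some) = weigh-cong em (yes some) (λ _ → some) (λ _ → pick-⊨ψ c some)
        mass-keep (no none)  = ≃-trans (mass-outside [] c ψ (λ ρ h k → none (ρ , h , k)))
                                       (≃-sym (measure-empty ω ⊥ᶠ (λ _ → id)))
      mass-outer (φ ∷ F) c = ≃-trans
        (⊕-cong (mass-outer F (c ∧ᶠ φ)) (mass-outer F (c ∧ᶠ ¬ᶠ φ)))
        (≃-sym (measure-∨ ω (outer F (c ∧ᶠ φ)) (outer F (c ∧ᶠ ¬ᶠ φ))
          λ ρ h k → proj₂ (outer-⊑ F (c ∧ᶠ ¬ᶠ φ) ρ k) (proj₂ (outer-⊑ F (c ∧ᶠ φ) ρ h))))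

      discretize-outer : ∀ F → measure (discretize F) ψ ≃ measure ω (outer F ⊤ᶠ)
      discretize-outer F = mass-outer F ⊤ᶠ

-- Uniform approximation of `ψ` over all extensions in `E`.

module Approximation
  (em : ∀ {ℓ} → ExcludedMiddle ℓ) (zorn : ∀ {p q r c} → ZornsLemma p q r c)
  {𝓛 : Language} (𝒰 : Structure 𝓛) (A : Pred (Carrier 𝒰) 0ℓ) {X Y : Set}
  (μ : 𝔐 𝒰 U X) (ν : 𝔐 𝒰 U Y) (λ′ : 𝔐 𝒰 A (X ⊎ Y)) (witness : Witnesses 𝒰 λ′ μ ν)
  (ψ : ℒ 𝒰 U Y) (ε : ℝ) (0<ε : 0ℝ < ε) where
  open Classical em
  open Ultrafilters em zorn
  open Measures em 𝒰 {U} {X ⊎ Y}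

  E′ : Pred (𝔐 𝒰 U (X ⊎ Y)) 0ℓ
  E′ = E 𝒰 λ′ μ

  Ψ : Fm
  Ψ = _↑ʸ 𝒰 {X = X} ψ

  -- A list of these is a finite subset of `𝔹` that carries its membership proofs.
  Generator : Set
  Generator = ∃[ φ ] 𝔹 𝒰 A {X} {Y} φ

  formulas : List Generator → List Fm
  formulas = map proj₁

  outer-𝔹 : ∀ θ F {c} → c ∈ 𝔹 𝒰 A → Outer.outer θ (formulas F) c ∈ 𝔹 𝒰 A
  outer-𝔹 θ [] {c} c∈ = keep-𝔹 em
    where
    keep-𝔹 : {P : Set} (d : Dec P) → Outer.keep θ d c ∈ 𝔹 𝒰 A
    keep-𝔹 (yes _) = c∈
    keep-𝔹 (no _)  = ⊥-closed
  outer-𝔹 θ ((φ , φ∈) ∷ F) c∈ = ∨-closed (outer-𝔹 θ F (∧-closed c∈ φ∈))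
                                         (outer-𝔹 θ F (∧-closed c∈ (¬-closed φ∈)))

  -- `inner` approximates the negation of `Ψ` from outside, so one construction serves both bounds.
  upper inner lower : List Generator → Fm
  upper F = Outer.outer Ψ (formulas F) ⊤ᶠ
  inner F = Outer.outer (¬ᶠ Ψ) (formulas F) ⊤ᶠ
  lower F = ¬ᶠ inner F

  lower-⊑ : ∀ F → lower F ⊑′ Ψ
  lower-⊑ F ρ ∉inner = decidable-stable em λ ¬Ψ →
    ∉inner (Outer.⊑-outer (¬ᶠ Ψ) (formulas F) ⊤ᶠ ρ (_ , ¬Ψ))

  ⊑-upper : ∀ F → Ψ ⊑′ upper F
  ⊑-upper F ρ h = Outer.⊑-outer Ψ (formulas F) ⊤ᶠ ρ (_ , h)

  Tight : List Generator → Set₁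
  Tight F = ∀ ω → ω ∈ E′ → measure ω (upper F) - measure ω (lower F) < ε

  E-marginal : ∀ ω → ω ∈ E′ → measure ω Ψ ≃ measure ν ψ
  E-marginal ω ω∈E = fromℝ≈ (proj₂ witness ω ω∈E ψ)

  module _ (loose : ∀ F → ¬ Tight F) where

    counterexample : ∀ F → ∃[ ω ] (ω ∈ E′ × ¬ (measure ω (upper F) - measure ω (lower F) < ε))
    counterexample F = decidable-stable em λ none →
      loose F λ ω ω∈E → decidable-stable em λ ≮ → none (ω , ω∈E , ≮)

    bad : List Generator → 𝔐 𝒰 U (X ⊎ Y)
    bad F = proj₁ (counterexample F)

    bad-∈E : ∀ F → bad F ∈ E′
    bad-∈E F = proj₁ (proj₂ (counterexample F))

    -- Adding the mass of `inner F` to both sides of `ε + lower ≤ upper` turns `lower + inner` into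
    -- 1. The result has no subtraction and passes to the limit.
    bad-gap : ∀ F → ε ⊕ 1ℝ ≼ measure (bad F) (upper F) ⊕ measure (bad F) (inner F)
    bad-gap F = ≼-trans
      (⊕-mono ≼-refl (≼-trans (proj₁ (measure-¬ (bad F) (inner F))) (⊕-comm-≼ _ _)))
      (≼-trans (⊕-assoc-≽ ε _ _)
        (⊕-mono (≮⇒⊕-≼ (proj₂ (proj₂ (counterexample F)))) ≼-refl))

    𝓖 : Filter (List Generator)
    𝓖 = proj₁ (ultrafilter eventually)

    𝓖-ultra : IsUltra 𝓖
    𝓖-ultra = proj₂ (proj₂ (ultrafilter eventually))

    𝓖-contains : ∀ g → (λ F → g ∈ᴸ F) ∈ large 𝓖
    𝓖-contains g = proj₁ (proj₂ (ultrafilter eventually)) (g ∷ [] , λ sub → sub (here refl))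

    open Limit em 𝓖 𝓖-ultra

    module _ (θ : Fm) where
      open Outer θ

      pushed : List Generator → 𝔐 𝒰 U (X ⊎ Y)
      pushed F = Discretize.discretize (bad F) pick pick-⊨ (formulas F)

      pushed-limit : 𝔐 𝒰 U (X ⊎ Y)
      pushed-limit = ultralimit 𝓖 𝓖-ultra pushed

      -- Almost every `F` lists `φ`, and for those the discretized measure agrees with `bad F` on
      -- `φ`.
      pushed-limit-determined : ∀ {φ x} → φ ∈ 𝔹 𝒰 A → (∀ F → measure (bad F) φ ≃ x) →
                                measure pushed-limit φ ≃ x
      pushed-limit-determined {φ} φ∈ bad≃x = lim-≃ (net 𝓖 𝓖-ultra pushed φ)
        (upward 𝓖 (λ {F} g∈F → ≃-trans
          (Discretize.discretize-agrees (bad F) pick pick-⊨ (∈-map⁺ proj₁ g∈F)) (bad≃x F))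
          (𝓖-contains (φ , φ∈)))

      -- Membership in `E′` prescribes values only on generators of `𝔹`, and there every `bad F` has
      -- the prescribed value.
      pushed-limit-∈E : pushed-limit ∈ E′
      pushed-limit-∈E =
          (λ φ → toℝ≈ (pushed-limit-determined {x = measure λ′ φ} (from-A φ)
                        λ F → fromℝ≈ (proj₁ (bad-∈E F) φ)))
        , (λ φ → toℝ≈ (pushed-limit-determined {x = measure μ φ} (from-x φ)
                        λ F → fromℝ≈ (proj₂ (bad-∈E F) φ)))

    contradiction : ⊥
    contradiction = ε⊕1⋠1 0<ε (≼-trans gap marginals)
      where
      ω⁺ ω⁻ : 𝔐 𝒰 U (X ⊎ Y)
      ω⁺ = pushed-limit Ψ
      ω⁻ = pushed-limit (¬ᶠ Ψ)

      gap : ε ⊕ 1ℝ ≼ measure ω⁺ Ψ ⊕ measure ω⁻ (¬ᶠ Ψ)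
      -- Both nets come from the same `bad F`: one discretization gives `Ψ` the mass of `upper F`,
      -- the other gives `¬ᶠ Ψ` the mass of `inner F`.
      gap = ≼-lim-⊕ (net 𝓖 𝓖-ultra (pushed Ψ) Ψ) (net 𝓖 𝓖-ultra (pushed (¬ᶠ Ψ)) (¬ᶠ Ψ))
        λ F → ≼-trans (bad-gap F)
          (⊕-mono (proj₂ (Outer.discretize-outer Ψ (bad F) (formulas F)))
                  (proj₂ (Outer.discretize-outer (¬ᶠ Ψ) (bad F) (formulas F))))

      marginals : measure ω⁺ Ψ ⊕ measure ω⁻ (¬ᶠ Ψ) ≼ 1ℝ
      marginals = ≼-trans
        -- Both limits give `Ψ` the mass `ν ψ`, so `ω⁺` may be replaced by `ω⁻`, under which `Ψ` and
        -- its negation add up to 1.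
        (⊕-mono (≼-trans (proj₁ (E-marginal ω⁺ (pushed-limit-∈E Ψ)))
                         (proj₂ (E-marginal ω⁻ (pushed-limit-∈E (¬ᶠ Ψ))))) ≼-refl)
        (proj₂ (measure-¬ ω⁻ Ψ))

  tight : ∃[ F ] Tight F
  tight = decidable-stable em λ none → contradiction λ F t → none (F , t)

  approximation :
    ∃[ χ⁻ ] ∃[ χ⁺ ]
      ( (χ⁻ ∈ 𝔹 𝒰 A) × (χ⁺ ∈ 𝔹 𝒰 A)
      × (_⊑_ 𝒰 χ⁻ Ψ × _⊑_ 𝒰 Ψ χ⁺)
      × (∀ ω → ω ∈ E′ → measure ω χ⁺ - measure ω χ⁻ < ε)
      × (∀ ω → ω ∈ E′ →
           ∣ measure ω χ⁺ - measure ν ψ ∣ < ε × ∣ measure ω χ⁻ - measure ν ψ ∣ < ε) )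
  approximation with tight
  ... | F , gap<ε =
      lower F , upper F
    , ¬-closed (outer-𝔹 (¬ᶠ Ψ) F ⊤-closed) , outer-𝔹 Ψ F ⊤-closed
    , (lower-⊑ F _ , ⊑-upper F _)
    , gap<ε
    , λ ω ω∈E →
        -- Since `ω` gives `Ψ` the mass `ν ψ`, monotonicity places `c` between `b` and `a`, which
        -- are less than `ε` apart.
        let a = measure ω (upper F)
            b = measure ω (lower F)
            c = measure ν ψ
            lower≼ν = ≼-trans (measure-mono ω (lower F) Ψ (lower-⊑ F))
                              (proj₁ (E-marginal ω ω∈E))
            ν≼upper = ≼-trans (proj₂ (E-marginal ω ω∈E))
                              (measure-mono ω Ψ (upper F) (⊑-upper F))
            lower≼upper = ≼-trans lower≼ν ν≼upper
        in ∣-∣<-within a b c a ε lower≼ν ν≼upper lower≼upper ≼-refl (gap<ε ω ω∈E)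
         , ∣-∣<-within a b c b ε lower≼ν ν≼upper ≼-refl lower≼upper (gap<ε ω ω∈E)

theorem3p18 : (∀ {ℓ} → ExcludedMiddle ℓ) →
    (∀ {p q r c} → ZornsLemma p q r c) →
    (𝓛 : Language) (T : Theory 𝓛) → IsComplete T →
    (𝒰 : Structure 𝓛) (κ : Set) → IsMonster 𝒰 κ T →
    (A : Pred (Carrier 𝒰) 0ℓ) → Small 𝒰 κ A →
    (n m : ℕ)
    (μ : 𝔐 𝒰 U (Fin n)) (ν : 𝔐 𝒰 U (Fin m)) (λ′ : 𝔐 𝒰 A (Fin n ⊎ Fin m)) →
    Witnesses 𝒰 λ′ μ ν →
    (ψ : ℒ 𝒰 U (Fin m)) (ε : ℝ) → 0ℝ < ε →
    ∃[ χ⁻ ] ∃[ χ⁺ ]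
    ( (χ⁻ ∈ 𝔹 𝒰 A) × (χ⁺ ∈ 𝔹 𝒰 A)
    × (_⊑_ 𝒰 χ⁻ (_↑ʸ 𝒰 {X = Fin n} ψ) × _⊑_ 𝒰 (_↑ʸ 𝒰 {X = Fin n} ψ) χ⁺)
    × (∀ ω → ω ∈ E 𝒰 λ′ μ → measure ω χ⁺ - measure ω χ⁻ < ε)
    × (∀ ω → ω ∈ E 𝒰 λ′ μ →
    ∣ measure ω χ⁺ - measure ν ψ ∣ < ε × ∣ measure ω χ⁻ - measure ν ψ ∣ < ε) )
theorem3p18 em zorn _ _ _ 𝒰 _ _ A _ _ _ μ ν λ′ witness ψ ε 0<ε =
  Approximation.approximation em zorn 𝒰 A μ ν λ′ witness ψ ε 0<ε
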